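{- Let $t\geq 1$ and $\ell\geq 2$ be integers. Then $$pc_{1,\ell}(Q_t)=\begin{cases} 1 & \text{if } t=1,\\ 2 & \text{if } t=2,\\ t & \text{if } t\geq 3 \text{ and } \ell\geq t,\\ \ell+1 & \text{if } t\geq 3 \text{ and } \ell<t.\end{cases}$$
   Context: The $t$-cube $Q_t$ is the graph whose vertices are the ordered $t$-tuples of $0$'s and $1$'s, two vertices being adjacent if and only if the $t$-tuples differ in exactly one coordinate. An edge-coloring of a graph is an arbitrary map from its edge set to the natural numbers (adjacent edges may share a color). In an edge-colored graph, a path $P$ is a distance $\ell$-proper path if no two edges of $P$ of the same color appear with fewer than $\ell$ edges in between on $P$. For a connected graph $G$, $pc_{1,\ell}(G)$ is the minimum number of colors in an edge-coloring of $G$ such that every pair of distinct vertices of $G$ is connected by at least one distance $\ell$-proper path. -}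

module Defs where

open import Data.Bool using (Bool)
open import Data.Fin as Fin using (Fin; toℕ)
open import Data.List using (List; []; _∷_; length; lookup)
open import Data.List.Membership.Propositional using (_∈_)
open import Data.List.Relation.Unary.Unique.Propositional using (Unique)
open import Data.Nat using (ℕ; suc; _∸_; _≤_)
open import Data.Product using (_×_; _,_; ∃!; ∃-syntax)
open import Data.Vec as Vec using (Vec)
open import Function.Bundles using (_⇔_)
open import Level using (0ℓ)
open import Relation.Binary.Core using (Rel)
open import Relation.Binary.Construct.Closure.ReflexiveTransitive using (Star; ε; _◅_)
open import Relation.Binary.Definitions using (Symmetric)
open import Relation.Binary.PropositionalEquality using (_≡_; _≢_; refl; ≢-sym)
open import Relation.Nullary using (¬_)

record Graph : Set₁ where
  field
    Vertex     : Set
    Adj        : Rel Vertex 0ℓ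
    adj-sym    : Symmetric Adj
    adj-irrefl : ∀ v → ¬ Adj v v

module _ (G : Graph) where
  open Graph G

  -- A map on unordered edges: applying `well-defined` twice also shows that the
  -- colour does not depend on the chosen proof of adjacency.
  record EdgeColouring : Set where
    field
      colour       : ∀ u v → Adj u v → ℕ
      well-defined : ∀ u v (p : Adj u v) (q : Adj v u) → colour u v p ≡ colour v u q

  Walk : Rel Vertex 0ℓ
  Walk = Star Adj

  vertices : ∀ {u v} → Walk u v → List Vertex
  vertices {u} ε       = u ∷ []
  vertices {u} (_ ◅ w) = u ∷ vertices w

  IsPath : ∀ {u v} → Walk u v → Set
  IsPath w = Unique (vertices w)

  module _ (c : EdgeColouring) where
    open EdgeColouring c

    colours : ∀ {u v} → Walk u v → List ℕ
    colours ε = []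
    colours (_◅_ {u} {v} e w) = colour u v e ∷ colours w

    -- The edges at positions i < j of a path have j ∸ (i + 1) edges between them.
    DistanceProper : ℕ → ∀ {u v} → Walk u v → Set
    DistanceProper ℓ w = ∀ (i j : Fin (length (colours w))) → i Fin.< j →
      lookup (colours w) i ≡ lookup (colours w) j → ℓ ≤ toℕ j ∸ suc (toℕ i)

    DistanceProperConnected : ℕ → Set
    DistanceProperConnected ℓ = ∀ u v → u ≢ v →
      ∃[ w ] IsPath {u} {v} w × DistanceProper ℓ w

    -- The image of the colouring has exactly n elements.
    NumberOfColours : ℕ → Set
    NumberOfColours n = ∃[ ks ] length ks ≡ n × Unique ks ×
      (∀ k → k ∈ ks ⇔ (∃[ u ] ∃[ v ] ∃[ e ] colour u v e ≡ k))

  -- pc₁,ℓ(G) = n: a minimum, so both attained and a lower bound.  The attained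
  -- half already forces G to be connected.
  IsPC₁ : ℕ → ℕ → Set
  IsPC₁ ℓ n =
    (∃[ c ] DistanceProperConnected c ℓ × NumberOfColours c n) ×
    (∀ c m → DistanceProperConnected c ℓ → NumberOfColours c m → n ≤ m)

DifferInExactlyOne : ∀ {t} → Rel (Vec Bool t) 0ℓ
DifferInExactlyOne u v = ∃! _≡_ λ i → Vec.lookup u i ≢ Vec.lookup v i

Q : ℕ → Graph
Q t = record
  { Vertex     = Vec Bool t
  ; Adj        = DifferInExactlyOne
  ; adj-sym    = λ (i , u≢v , uniq) → i , ≢-sym u≢v , λ v≢u → uniq (≢-sym v≢u)
  ; adj-irrefl = λ _ (_ , v≢v , _) → v≢v refl
  }

{-# OPTIONS --safe #-}
module Submission where

-- Lower bound: a path between antipodal vertices uses all t directions, and any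
-- ℓ + 1 consecutive edges of a distance ℓ-proper path have distinct colours.
--
-- Upper bound: for ℓ ≥ t colour each edge by its direction.  For ℓ < t give each of
-- the first ℓ directions a colour of its own and let all others share one more colour c.
-- Given u and v, let O (resp. E) list the first ℓ directions in which u and v differ
-- (resp. agree), and s₁, …, sₘ the others in which they differ.  The walk
-- O (E s₁ O) (E s₂ O) … (E sₘ O) has a periodic colour sequence of period ℓ + 1 and
-- flips E m times and O m + 1 times, so it reaches v when m is even; when m is odd,
-- drop the first O and E.  It is a path because a nonempty stretch of it either
-- contains some sᵢ, which is flipped only once, or lies inside O E.

open import Defs
open import Data.Bool using (Bool; true; false; not; _xor_)
open import Data.Bool.Properties as Bool
  using (xor-assoc; xor-comm; xor-identityʳ; xor-same; true-xor; not-¬)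
open import Data.Bool.Solver using (module xor-∧-Solver)
open import Data.Empty using (⊥-elim)
open import Data.Fin as Fin using (Fin; zero; suc; toℕ; fromℕ<; inject≤)
open import Data.Fin.Properties as Fin
  using (toℕ<n; toℕ-fromℕ<; toℕ-inject≤; toℕ-injective; inject≤-injective; injective⇒≤)
open import Data.List
  using (List; []; _∷_; _++_; [_]; length; lookup; map; take; filter; concat; replicate; allFin; upTo)
open import Data.List.Membership.Propositional using (_∈_)
open import Data.List.Membership.Propositional.Properties
  using (∈-filter⁺; ∈-filter⁻; ∈-allFin; ∈-++⁺ˡ; ∈-++⁺ʳ; ∈-++⁻; ∈-map⁺; ∈-map⁻; ∈-upTo⁺; ∈-upTo⁻)
open import Data.List.Properties
  using (++-assoc; ++-identityʳ; map-++; map-cong-local; length-map; length-tabulate; length-upTo; partition-defn)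
open import Data.List.Relation.Binary.Permutation.Propositional
  using (_↭_; ↭-sym; ↭-trans; ↭-reflexive; ↭⇒↭ₛ; ↭ₛ⇒↭; prep)
open import Data.List.Relation.Binary.Permutation.Propositional.Properties
  using (↭-length; ++-comm; shift; map⁺)
import Data.List.Relation.Binary.Permutation.Setoid.Properties as ↭ₛ
open import Data.List.Relation.Unary.All as All using (All; []; _∷_)
import Data.List.Relation.Unary.All.Properties as All
open import Data.List.Relation.Unary.AllPairs using ([]; _∷_)
open import Data.List.Relation.Unary.Any as Any using (here; there)
open import Data.List.Relation.Unary.Any.Properties using (lookup-index)
open import Data.List.Relation.Unary.Unique.Propositional using (Unique)
import Data.List.Relation.Unary.Unique.Propositional.Properties as Unique
open import Data.Nat using (ℕ; zero; suc; _+_; _∸_; _⊓_; _≤_; _<_; _≥_; z≤n; s≤s; z<s; _≤?_)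
open import Data.Nat.Properties as ℕ
open import Data.Product using (_×_; _,_; proj₁; proj₂; ∃-syntax)
open import Data.Sum using (_⊎_; inj₁; inj₂)
open import Data.Unit using (⊤; tt)
open import Data.Vec as Vec using (Vec)
open import Data.Vec.Properties
  using (lookup∘updateAt; lookup∘updateAt′; lookup-replicate; tabulate∘lookup; tabulate-cong)
open import Function using (_∘_; case_of_)
open import Function.Bundles using (mk⇔; Equivalence)
open import Relation.Binary.Construct.Closure.ReflexiveTransitive using (ε; _◅_)
open import Relation.Binary.Definitions using (tri<; tri≈; tri>)
open import Relation.Binary.PropositionalEquality
  using (_≡_; _≢_; refl; sym; trans; cong; subst; subst₂; ≢-sym; setoid; module ≡-Reasoning)
open import Relation.Nullary using (Dec; does; yes; no; contradiction)
open import Relation.Nullary.Decidable using (¬?; dec-true; dec-false)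

private
  variable
    A   : Set
    t ℓ : ℕ

-- Lists without repetition, permutations and prefixes.

Unique-resp-↭ : {xs ys : List A} → xs ↭ ys → Unique xs → Unique ys
Unique-resp-↭ p = ↭ₛ.Unique-resp-↭ (setoid _) (↭⇒↭ₛ p)

filter-↭ : {P : A → Set} (P? : ∀ x → Dec (P x)) (xs : List A) →
  xs ↭ filter P? xs ++ filter (¬? ∘ P?) xs
filter-↭ P? xs = subst (λ (ys , zs) → xs ↭ ys ++ zs) (partition-defn P? xs)
  (↭ₛ⇒↭ (↭ₛ.partition-↭ (setoid _) P? xs))

take-length-++ : (xs ys : List A) → take (length xs) (xs ++ ys) ≡ xs
take-length-++ []       ys = refl
take-length-++ (x ∷ xs) ys = cong (x ∷_) (take-length-++ xs ys)

Unique-++⁻ˡ : (xs : List A) {ys : List A} → Unique (xs ++ ys) → Unique xs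
Unique-++⁻ˡ []       u        = []
Unique-++⁻ˡ (x ∷ xs) (x≢ ∷ u) = All.++⁻ˡ xs x≢ ∷ Unique-++⁻ˡ xs u

-- Spaced sequences of colours

-- Two entries with fewer than ℓ entries in between are at most ℓ positions apart, so distance
-- ℓ-properness compares each entry with the ℓ entries that follow it.
Spaced : ℕ → List A → Set
Spaced ℓ []       = ⊤
Spaced ℓ (c ∷ cs) = All (c ≢_) (take ℓ cs) × Spaced ℓ cs

lookup∈take : (cs : List A) (j : Fin (length cs)) → toℕ j < ℓ → lookup cs j ∈ take ℓ cs
lookup∈take {ℓ = suc ℓ} (c ∷ cs) zero    _         = here refl
lookup∈take {ℓ = suc ℓ} (c ∷ cs) (suc j) (s≤s j<ℓ) = there (lookup∈take cs j j<ℓ)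

Spaced⇒distance : (cs : List A) → Spaced ℓ cs → ∀ (i j : Fin (length cs)) → i Fin.< j →
  lookup cs i ≡ lookup cs j → ℓ ≤ toℕ j ∸ suc (toℕ i)
Spaced⇒distance (c ∷ cs) (c≢ , _) zero    (suc j) _         eq =
  ≮⇒≥ λ j<ℓ → All.lookup c≢ (lookup∈take cs j j<ℓ) eq
Spaced⇒distance (c ∷ cs) (_ , sp) (suc i) (suc j) (s≤s i<j) eq = Spaced⇒distance cs sp i j i<j eq

Unique⇒Spaced : {cs : List A} → Unique cs → Spaced ℓ cs
Unique⇒Spaced []       = tt
Unique⇒Spaced {ℓ = ℓ} (c≢ ∷ u) = All.take⁺ ℓ c≢ , Unique⇒Spaced u

Spaced-dropˡ : (xs : List A) {ys : List A} → Spaced ℓ (xs ++ ys) → Spaced ℓ ys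
Spaced-dropˡ []       sp = sp
Spaced-dropˡ (x ∷ xs) sp = Spaced-dropˡ xs (proj₂ sp)

-- Any ℓ + 1 consecutive entries form a rotation of `P`, which has no repetition. The induction is
-- over the copies of `P`; `suffix` runs through the first copy, `as` being the part already passed.
Spaced-cycle : {P : List A} → Unique P → length P ≡ suc ℓ → ∀ n → Spaced ℓ (concat (replicate n P))
Spaced-cycle uniq len zero = tt
Spaced-cycle {ℓ = ℓ} {P} uniq len (suc n) = suffix [] P refl
  where
  C = concat (replicate n P)

  -- After `x` come the rest `bs` of its own copy and the start `as` of the next one, together ℓ
  -- entries; after the last copy only `bs` is left.
  window : ∀ as x bs → P ≡ as ++ x ∷ bs → All (x ≢_) (bs ++ as) → length (bs ++ as) ≡ ℓ →
    ∀ m → All (x ≢_) (take ℓ (bs ++ concat (replicate m P)))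
  window as x bs eq x≢ len′ zero =
    All.take⁺ ℓ (subst (All (x ≢_)) (sym (++-identityʳ bs)) (All.++⁻ˡ bs x≢))
  window as x bs eq x≢ len′ (suc m) = subst (All (x ≢_)) (sym unfold) x≢
    where
    open ≡-Reasoning
    R = concat (replicate m P)
    unfold : take ℓ (bs ++ P ++ R) ≡ bs ++ as
    unfold = begin
      take ℓ (bs ++ P ++ R)                        ≡⟨ cong (λ p → take ℓ (bs ++ p ++ R)) eq ⟩
      take ℓ (bs ++ (as ++ x ∷ bs) ++ R)           ≡⟨ cong (λ z → take ℓ (bs ++ z)) (++-assoc as (x ∷ bs) R) ⟩
      take ℓ (bs ++ as ++ x ∷ bs ++ R)             ≡⟨ cong (take ℓ) (++-assoc bs as _) ⟨
      take ℓ ((bs ++ as) ++ x ∷ bs ++ R)           ≡⟨ cong (λ k → take k ((bs ++ as) ++ x ∷ bs ++ R)) len′ ⟨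
      take (length (bs ++ as)) ((bs ++ as) ++ x ∷ bs ++ R) ≡⟨ take-length-++ (bs ++ as) _ ⟩
      bs ++ as                                     ∎

  suffix : ∀ as bs → P ≡ as ++ bs → Spaced ℓ (bs ++ C)
  suffix as []       eq = Spaced-cycle uniq len n
  suffix as (x ∷ bs) eq =
    window as x bs eq x≢
      (suc-injective (trans (sym (↭-length (++-comm as (x ∷ bs)))) (trans (cong length (sym eq)) len))) n
    , suffix (as ++ [ x ]) bs (trans eq (sym (++-assoc as [ x ] bs)))
    where
    x≢ : All (x ≢_) (bs ++ as)
    x≢ = case Unique-resp-↭ (++-comm as (x ∷ bs)) (subst Unique eq uniq) of λ where (p ∷ _) → p

-- Walks in the cube as lists of directions

xor-swap : ∀ x y z → x xor (y xor z) ≡ y xor (x xor z)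
xor-swap = solve 3 (λ x y z → x :+ (y :+ z) := y :+ (x :+ z)) refl
  where open xor-∧-Solver

-- The coordinate `i` of the displacement modulo 2: the order and the even repetitions of flips do
-- not affect the end point.
parity : Fin t → List (Fin t) → Bool
parity i []       = false
parity i (d ∷ ds) = does (i Fin.≟ d) xor parity i ds

parity-++ : ∀ (i : Fin t) xs ys → parity i (xs ++ ys) ≡ parity i xs xor parity i ys
parity-++ i []       ys = refl
parity-++ i (x ∷ xs) ys =
  trans (cong (does (i Fin.≟ x) xor_) (parity-++ i xs ys)) (sym (xor-assoc (does (i Fin.≟ x)) _ _))

parity-∷-≡ : ∀ (i : Fin t) ds → parity i (i ∷ ds) ≡ not (parity i ds)
parity-∷-≡ i ds rewrite dec-true (i Fin.≟ i) refl = refl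

parity-∷-≢ : ∀ {i d : Fin t} ds → i ≢ d → parity i (d ∷ ds) ≡ parity i ds
parity-∷-≢ {i = i} {d} ds i≢d rewrite dec-false (i Fin.≟ d) i≢d = refl

parity-∉ : ∀ (i : Fin t) {ds} → All (i ≢_) ds → parity i ds ≡ false
parity-∉ i []         = refl
parity-∉ i {_ ∷ ds} (i≢d ∷ ps) = trans (parity-∷-≢ ds i≢d) (parity-∉ i ps)

parity-head : ∀ (i : Fin t) {ds} → All (i ≢_) ds → parity i (i ∷ ds) ≡ true
parity-head i {ds} i∉ = trans (parity-∷-≡ i ds) (cong not (parity-∉ i i∉))

parity-∈ : ∀ (i : Fin t) {ds} → Unique ds → i ∈ ds → parity i ds ≡ true
parity-∈ i (d≢ ∷ _) (here refl) = parity-head i d≢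
parity-∈ i {_ ∷ ds} (d≢ ∷ u) (there i∈)  =
  trans (parity-∷-≢ ds (≢-sym (All.lookup d≢ i∈))) (parity-∈ i u i∈)

flip : Fin t → Vec Bool t → Vec Bool t
flip d u = Vec.updateAt u d not

flips : List (Fin t) → Vec Bool t → Vec Bool t
flips []       u = u
flips (d ∷ ds) u = flips ds (flip d u)

flip-lookup : ∀ (d i : Fin t) u → Vec.lookup (flip d u) i ≡ Vec.lookup u i xor does (i Fin.≟ d)
flip-lookup d i u with i Fin.≟ d
... | yes refl = trans (lookup∘updateAt i u) (trans (sym (true-xor _)) (xor-comm true _))
... | no  i≢d  = trans (lookup∘updateAt′ i d i≢d u) (sym (xor-identityʳ _))

flips-lookup : ∀ ds (i : Fin t) u → Vec.lookup (flips ds u) i ≡ Vec.lookup u i xor parity i ds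
flips-lookup []       i u = sym (xor-identityʳ _)
flips-lookup (d ∷ ds) i u = trans (flips-lookup ds i (flip d u))
  (trans (cong (_xor parity i ds) (flip-lookup d i u)) (xor-assoc (Vec.lookup u i) _ _))

flip-adj : ∀ (d : Fin t) u → DifferInExactlyOne u (flip d u)
flip-adj d u = d , (λ eq → not-¬ refl (trans eq (lookup∘updateAt d u))) , λ {j} → only j
  where
  only : ∀ j → Vec.lookup u j ≢ Vec.lookup (flip d u) j → d ≡ j
  only j u≢ with j Fin.≟ d
  ... | yes j≡d = sym j≡d
  ... | no  j≢d = ⊥-elim (u≢ (sym (lookup∘updateAt′ j d j≢d u)))

walk : ∀ ds (u : Vec Bool t) → Walk (Q t) u (flips ds u)
walk []       u = ε
walk (d ∷ ds) u = flip-adj d u ◅ walk ds (flip d u)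

∈-vertices-walk : ∀ ds (u : Vec Bool t) {w} → w ∈ vertices (Q t) (walk ds u) →
  ∃[ n ] w ≡ flips (take n ds) u
∈-vertices-walk []       u (here refl) = 0 , refl
∈-vertices-walk (d ∷ ds) u (here refl) = 0 , refl
∈-vertices-walk (d ∷ ds) u (there w∈)  =
  let n , eq = ∈-vertices-walk ds (flip d u) w∈ in suc n , eq

-- The prefixes of all suffixes are the stretches of the list. A direction of odd parity in a
-- stretch separates its two ends, whatever the starting vertex.
NonReturning : List (Fin t) → Set
NonReturning []       = ⊤
NonReturning (d ∷ ds) = (∀ n → ∃[ i ] parity i (d ∷ take n ds) ≡ true) × NonReturning ds

-- A vertex visited twice would differ from itself in the odd direction of the stretch between the
-- two visits.
NonReturning⇒IsPath : ∀ ds (u : Vec Bool t) → NonReturning ds → IsPath (Q t) (walk ds u)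
NonReturning⇒IsPath []       u _          = [] ∷ []
NonReturning⇒IsPath (d ∷ ds) u (odd , nr) =
  All.tabulate fresh ∷ NonReturning⇒IsPath ds (flip d u) nr
  where
  fresh : ∀ {w} → w ∈ vertices (Q _) (walk ds (flip d u)) → u ≢ w
  fresh w∈ u≡w with ∈-vertices-walk ds (flip d u) w∈
  ... | n , w≡ with odd n
  ... | i , p = not-¬ refl (begin
      Vec.lookup u i                                  ≡⟨ cong (λ x → Vec.lookup x i) (trans u≡w w≡) ⟩
      Vec.lookup (flips (d ∷ take n ds) u) i          ≡⟨ flips-lookup (d ∷ take n ds) i u ⟩
      Vec.lookup u i xor parity i (d ∷ take n ds)     ≡⟨ cong (Vec.lookup u i xor_) p ⟩
      Vec.lookup u i xor true                         ≡⟨ xor-comm _ true ⟩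
      not (Vec.lookup u i)                            ∎)
    where open ≡-Reasoning

-- Every nonempty stretch flips its first direction exactly once.
Unique⇒NonReturning : {ds : List (Fin t)} → Unique ds → NonReturning ds
Unique⇒NonReturning []       = tt
Unique⇒NonReturning {ds = d ∷ _} (d≢ ∷ u) = (λ n → d , parity-head _ (All.take⁺ n d≢)) , Unique⇒NonReturning u

-- A prefix of xs ++ s ∷ ys either reaches s, which occurs only once, or stays within xs.
NonReturning-insert : ∀ {s : Fin t} xs {ys} → Unique xs → All (s ≢_) xs → All (s ≢_) ys →
  NonReturning ys → NonReturning (xs ++ s ∷ ys)
NonReturning-insert {s = s} []       _         _           s∉ys nr =
  (λ n → s , parity-head _ (All.take⁺ n s∉ys)) , nr
NonReturning-insert {s = s} (x ∷ xs) {ys} (x≢ ∷ u) (s≢x ∷ s∉xs) s∉ys nr =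
  odd , NonReturning-insert xs u s∉xs s∉ys nr
  where
  prefix : ∀ {xs} → All (s ≢_) xs → ∀ n →
    parity s (take n (xs ++ s ∷ ys)) ≡ true ⊎ take n (xs ++ s ∷ ys) ≡ take n xs
  prefix _            zero    = inj₂ refl
  prefix []           (suc n) = inj₁ (parity-head _ (All.take⁺ n s∉ys))
  prefix (s≢y ∷ s∉xs) (suc n) with prefix s∉xs n
  ... | inj₁ p  = inj₁ (trans (parity-∷-≢ (take n (_ ++ s ∷ ys)) s≢y) p)
  ... | inj₂ eq = inj₂ (cong (_ ∷_) eq)

  odd : ∀ n → ∃[ i ] parity i (x ∷ take n (xs ++ s ∷ ys)) ≡ true
  odd n with prefix s∉xs n
  ... | inj₁ p  = s , trans (parity-∷-≢ (take n (xs ++ s ∷ ys)) s≢x) p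
  ... | inj₂ eq = x , parity-head _ (subst (All (x ≢_)) (sym eq) (All.take⁺ n x≢))

-- The walk joining u and v

module Route {t ℓ : ℕ} (col : Fin t → ℕ) (c : ℕ) (O E : List (Fin t)) where

  -- The walk without its leading `O`, cut into blocks `E s O` so that each block carries one full
  -- period of colours.
  rounds : List (Fin t) → List (Fin t)
  rounds []       = []
  rounds (s ∷ ss) = E ++ s ∷ O ++ rounds ss

  -- The displacement after an even and after an odd number of blocks: in the first case all copies
  -- of `E` and `O` cancel, in the second a further copy of each is added to cancel the one left
  -- over.
  Even Odd : List (Fin t) → Set
  Even ss = ∀ i → parity i (rounds ss) ≡ parity i ss
  Odd  ss = ∀ i → parity i E xor (parity i O xor parity i (rounds ss)) ≡ parity i ss

  parity-rounds-∷ : ∀ i s ss → parity i (rounds (s ∷ ss)) ≡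
    parity i E xor (does (i Fin.≟ s) xor (parity i O xor parity i (rounds ss)))
  parity-rounds-∷ i s ss = trans (parity-++ i E _)
    (cong (λ z → parity i E xor (does (i Fin.≟ s) xor z)) (parity-++ i O _))

  -- Each further block contributes one more `E` and one more `O`, which turns either case into the
  -- other.
  even⊎odd : ∀ ss → Even ss ⊎ Odd ss
  even⊎odd []       = inj₁ λ _ → refl
  even⊎odd (s ∷ ss) with even⊎odd ss
  ... | inj₁ h = inj₂ λ i → begin
      parity i E xor (parity i O xor parity i (rounds (s ∷ ss)))
        ≡⟨ cong (λ z → parity i E xor (parity i O xor z)) (parity-rounds-∷ i s ss) ⟩
      parity i E xor (parity i O xor (parity i E xor (does (i Fin.≟ s) xor (parity i O xor parity i (rounds ss)))))
        ≡⟨ cancel (parity i E) (parity i O) (does (i Fin.≟ s)) (parity i (rounds ss)) ⟩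
      does (i Fin.≟ s) xor parity i (rounds ss)
        ≡⟨ cong (does (i Fin.≟ s) xor_) (h i) ⟩
      parity i (s ∷ ss) ∎
    where
    open ≡-Reasoning
    cancel : ∀ e o b g → e xor (o xor (e xor (b xor (o xor g)))) ≡ b xor g
    cancel = solve 4 (λ e o b g → e :+ (o :+ (e :+ (b :+ (o :+ g)))) := b :+ g) refl
      where open xor-∧-Solver
  ... | inj₂ h = inj₁ λ i → trans (parity-rounds-∷ i s ss)
      (trans (xor-swap (parity i E) (does (i Fin.≟ s)) _) (cong (does (i Fin.≟ s) xor_) (h i)))

  -- O is flipped once more than E along O ++ rounds ss; starting at the first s instead
  -- reverses both parities.
  rotation : ∀ ss → ∃[ ds ] (∀ i → parity i ds ≡ parity i (O ++ ss)) ×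
    (ds ≡ O ++ rounds ss ⊎ ∃[ s ] ∃[ ss′ ] ss ≡ s ∷ ss′ × ds ≡ s ∷ O ++ rounds ss′)
  rotation []       = O ++ [] , (λ _ → refl) , inj₁ refl
  rotation (s ∷ ss) with even⊎odd ss
  ... | inj₁ h = s ∷ O ++ rounds ss , par , inj₂ (s , ss , refl , refl)
    where
    open ≡-Reasoning
    par : ∀ i → parity i (s ∷ O ++ rounds ss) ≡ parity i (O ++ s ∷ ss)
    par i = begin
      does (i Fin.≟ s) xor parity i (O ++ rounds ss)
        ≡⟨ cong (does (i Fin.≟ s) xor_) (parity-++ i O _) ⟩
      does (i Fin.≟ s) xor (parity i O xor parity i (rounds ss))
        ≡⟨ xor-swap (does (i Fin.≟ s)) (parity i O) _ ⟩
      parity i O xor (does (i Fin.≟ s) xor parity i (rounds ss))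
        ≡⟨ cong (λ z → parity i O xor (does (i Fin.≟ s) xor z)) (h i) ⟩
      parity i O xor parity i (s ∷ ss)
        ≡⟨ parity-++ i O _ ⟨
      parity i (O ++ s ∷ ss) ∎
  ... | inj₂ h = O ++ rounds (s ∷ ss) , par , inj₁ refl
    where
    open ≡-Reasoning
    par : ∀ i → parity i (O ++ rounds (s ∷ ss)) ≡ parity i (O ++ s ∷ ss)
    par i = begin
      parity i (O ++ rounds (s ∷ ss))
        ≡⟨ parity-++ i O _ ⟩
      parity i O xor parity i (rounds (s ∷ ss))
        ≡⟨ cong (parity i O xor_) (parity-rounds-∷ i s ss) ⟩
      parity i O xor (parity i E xor (does (i Fin.≟ s) xor (parity i O xor parity i (rounds ss))))
        ≡⟨ cong (parity i O xor_) (xor-swap (parity i E) (does (i Fin.≟ s)) _) ⟩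
      parity i O xor (does (i Fin.≟ s) xor (parity i E xor (parity i O xor parity i (rounds ss))))
        ≡⟨ cong (λ z → parity i O xor (does (i Fin.≟ s) xor z)) (h i) ⟩
      parity i O xor parity i (s ∷ ss)
        ≡⟨ parity-++ i O _ ⟨
      parity i (O ++ s ∷ ss) ∎

  module _ (uniq : Unique (c ∷ map col (O ++ E))) (len : length (O ++ E) ≡ ℓ) where

    OE-unique : Unique (O ++ E)
    OE-unique = case uniq of λ where (_ ∷ u) → Unique.map⁻ u

    ∉OE : ∀ {s} → col s ≡ c → All (s ≢_) (O ++ E)
    ∉OE {s} big = All.tabulate λ x∈ s≡x →
      Unique.Unique[x∷xs]⇒x∉xs uniq (subst (_∈ _) (trans (cong col (sym s≡x)) big) (∈-map⁺ col x∈))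

    ∉rounds : ∀ {s} → col s ≡ c → ∀ {ss} → All (s ≢_) ss → All (s ≢_) (O ++ rounds ss)
    ∉rounds big []           = All.++⁺ (All.++⁻ˡ O (∉OE big)) []
    ∉rounds big (s≢s′ ∷ s∉) =
      All.++⁺ (All.++⁻ˡ O (∉OE big)) (All.++⁺ (All.++⁻ʳ O (∉OE big)) (s≢s′ ∷ ∉rounds big s∉))

    -- Induction with the walk bracketed as `(O E) s` followed by the remaining walk: `s` has colour
    -- `c`, so it is not in `O ++ E`, and it is not repeated in `ss`.
    rounds-nonReturning : ∀ {ss} → Unique ss → All (λ s → col s ≡ c) ss → NonReturning (O ++ rounds ss)
    rounds-nonReturning [] _ = subst NonReturning (sym (++-identityʳ O)) (Unique⇒NonReturning (Unique-++⁻ˡ O OE-unique))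
    rounds-nonReturning {s ∷ ss} (s∉ ∷ u) (big ∷ bigs) =
      subst NonReturning (++-assoc O E _)
        (NonReturning-insert (O ++ E) OE-unique (∉OE big) (∉rounds big s∉) (rounds-nonReturning u bigs))

    -- The colours of one block, a period of length ℓ + 1.
    P : List ℕ
    P = map col E ++ c ∷ map col O

    OE↭P : c ∷ map col (O ++ E) ↭ P
    OE↭P = ↭-sym (↭-trans (shift c (map col E) (map col O))
      (prep c (↭-trans (++-comm (map col E) (map col O)) (↭-reflexive (sym (map-++ col O E))))))

    map-rounds : ∀ {ss} → All (λ s → col s ≡ c) ss → map col (rounds ss) ≡ concat (replicate (length ss) P)
    map-rounds []                     = refl
    map-rounds {s ∷ ss} (refl ∷ bigs) = begin
      map col (E ++ s ∷ O ++ rounds ss)                           ≡⟨ map-++ col E _ ⟩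
      map col E ++ col s ∷ map col (O ++ rounds ss)               ≡⟨ cong (λ z → map col E ++ col s ∷ z) (map-++ col O _) ⟩
      map col E ++ col s ∷ map col O ++ map col (rounds ss)       ≡⟨ ++-assoc (map col E) (col s ∷ map col O) _ ⟨
      P ++ map col (rounds ss)                                    ≡⟨ cong (P ++_) (map-rounds bigs) ⟩
      P ++ concat (replicate (length ss) P)                       ∎
      where open ≡-Reasoning

    -- This is the colour sequence of one block more than `ss` supplies, with its first `E` cut off.
    -- The leading `c` is the colour of the direction that starts the rotated walk; without it the
    -- sequence belongs to the other walk.
    rounds-spaced : ∀ {ss} → All (λ s → col s ≡ c) ss → Spaced ℓ (c ∷ map col (O ++ rounds ss))
    rounds-spaced {ss} bigs = subst (Spaced ℓ ∘ (c ∷_)) (sym (trans (map-++ col O _) (cong (map col O ++_) (map-rounds bigs))))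
      (Spaced-dropˡ (map col E) (subst (Spaced ℓ) (++-assoc (map col E) _ _)
        (Spaced-cycle (Unique-resp-↭ OE↭P uniq)
          (trans (sym (↭-length OE↭P)) (cong suc (trans (length-map col (O ++ E)) len))) (suc (length ss)))))

    route : ∀ {ss} → Unique ss → All (λ s → col s ≡ c) ss →
      ∃[ ds ] (∀ i → parity i ds ≡ parity i (O ++ ss)) × NonReturning ds × Spaced ℓ (map col ds)
    route {ss} u bigs with rotation ss
    ... | ds , par , inj₁ refl = ds , par , rounds-nonReturning u bigs , proj₂ (rounds-spaced bigs)
    -- The rotated walk starts with `s`, which never recurs, so the insertion is into an empty list.
    route (s∉ ∷ u) (refl ∷ bigs) | ds , par , inj₂ (s , ss , refl , refl) =
      ds , par , NonReturning-insert [] [] [] (∉rounds refl s∉) (rounds-nonReturning u bigs)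
      , rounds-spaced bigs

-- Upper bound

colouring : (col : Fin t → ℕ) → EdgeColouring (Q t)
colouring col = record
  { colour       = λ _ _ (i , _) → col i
  ; well-defined = λ _ _ (_ , _ , only) (_ , v≢u , _) → cong col (only (≢-sym v≢u))
  }

colours-walk : ∀ col ds (u : Vec Bool t) → colours (Q t) (colouring col) (walk ds u) ≡ map col ds
colours-walk col []       u = refl
colours-walk col (d ∷ ds) u = cong (col d ∷_) (colours-walk col ds (flip d u))

Vec-ext : {u v : Vec A t} → (∀ i → Vec.lookup u i ≡ Vec.lookup v i) → u ≡ v
Vec-ext {u = u} {v} eq = trans (sym (tabulate∘lookup u)) (trans (tabulate-cong eq) (tabulate∘lookup v))

connect : ∀ (col : Fin t → ℕ) {u v} ds → (∀ i → parity i ds ≡ Vec.lookup u i xor Vec.lookup v i) →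
  NonReturning ds → Spaced ℓ (map col ds) →
  ∃[ w ] IsPath (Q t) {u} {v} w × DistanceProper (Q t) (colouring col) ℓ w
connect col {u} {v} ds par nr sp = to v (Vec-ext end)
  where
  cancel : ∀ x y → x xor (x xor y) ≡ y
  cancel x y = trans (sym (xor-assoc x x y)) (cong (_xor y) (xor-same x))
  end : ∀ i → Vec.lookup (flips ds u) i ≡ Vec.lookup v i
  end i = trans (flips-lookup ds i u) (trans (cong (Vec.lookup u i xor_) (par i)) (cancel (Vec.lookup u i) _))
  -- The end point is generalised so that its equality with `flips ds u` can be matched.
  to : ∀ v → flips ds u ≡ v → ∃[ w ] IsPath (Q _) {u} {v} w × DistanceProper (Q _) (colouring col) _ w
  to _ refl = walk ds u , NonReturning⇒IsPath ds u nr ,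
    Spaced⇒distance _ (subst (Spaced _) (sym (colours-walk col ds u)) sp)

module _ (u v : Vec Bool t) where

  differ? : ∀ i → Dec (Vec.lookup u i ≢ Vec.lookup v i)
  differ? i = ¬? (Vec.lookup u i Bool.≟ Vec.lookup v i)

  -- In a list without repetition parity is membership, and the xor of two bits tells whether they
  -- differ.
  parity-differ : ∀ {ds} → Unique ds → (∀ i → i ∈ ds → Vec.lookup u i ≢ Vec.lookup v i) →
    (∀ i → Vec.lookup u i ≢ Vec.lookup v i → i ∈ ds) →
    ∀ i → parity i ds ≡ Vec.lookup u i xor Vec.lookup v i
  parity-differ uniq sound complete i with Vec.lookup u i Bool.≟ Vec.lookup v i
  ... | no  u≢v = trans (parity-∈ i uniq (complete i u≢v)) (sym (xor-≢ _ _ u≢v))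
    where
    xor-≢ : ∀ x y → x ≢ y → x xor y ≡ true
    xor-≢ false y x≢y = Bool.¬-not (≢-sym x≢y)
    xor-≢ true  y x≢y = sym (Bool.¬-not x≢y)
  ... | yes u≡v = trans (parity-∉ i (All.tabulate λ x∈ i≡x → sound i (subst (_∈ _) (sym i≡x) x∈) u≡v))
      (trans (sym (xor-same (Vec.lookup u i))) (cong (Vec.lookup u i xor_) u≡v))

-- Each of the first c directions has a colour of its own; all others share the colour c.
capped : ℕ → Fin t → ℕ
capped c d = toℕ d ⊓ c

cappedColouring : ℕ → EdgeColouring (Q t)
cappedColouring c = colouring (capped c)

cappedColouring-number : ∀ {c} → c < t → NumberOfColours (Q t) (cappedColouring c) (suc c)
cappedColouring-number {t} {c} c<t = upTo (suc c) , length-upTo (suc c) , Unique.upTo⁺ (suc c) , λ k → mk⇔ (to k) (from k)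
  where
  zeros : Vec Bool t
  zeros = Vec.replicate t false
  to : ∀ k → k ∈ upTo (suc c) → ∃[ u ] ∃[ v ] ∃[ e ] EdgeColouring.colour (cappedColouring c) u v e ≡ k
  -- Since `c < t`, every `k ≤ c` is itself a direction, and its colour is `k`.
  to k k∈ = let k≤c = ℕ.≤-pred (∈-upTo⁻ k∈) ; k<t = ≤-<-trans k≤c c<t in
    zeros , flip (fromℕ< k<t) zeros , flip-adj (fromℕ< k<t) zeros ,
    trans (cong (_⊓ c) (toℕ-fromℕ< k<t)) (m≤n⇒m⊓n≡m k≤c)
  from : ∀ k → ∃[ u ] ∃[ v ] ∃[ e ] EdgeColouring.colour (cappedColouring c) u v e ≡ k → k ∈ upTo (suc c)
  from _ (_ , _ , (i , _) , refl) = ∈-upTo⁺ (s≤s (m⊓n≤n (toℕ i) c))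

-- The number `c` plays three parts: the distance, the number of directions with a colour of their
-- own, and the shared colour.
cappedColouring-connected : ∀ {c} → c < t → DistanceProperConnected (Q t) (cappedColouring c) c
cappedColouring-connected {t} {c} c<t u v _ =
  let ds , par , nr , sp = route uniq len (Unique.filter⁺ (differ? u v) large-unique)
                             (All.tabulate (large-col ∘ proj₁ ∘ ∈-filter⁻ (differ? u v)))
  in connect (capped c) ds (λ i → trans (par i) (parity-differ u v OS-unique sound complete i)) nr sp
  where
  small large O E S : List (Fin t)
  small = map (λ i → inject≤ i (<⇒≤ c<t)) (allFin c)
  large = filter (λ i → c ≤? toℕ i) (allFin t)
  O     = filter (differ? u v) small
  E     = filter (¬? ∘ differ? u v) small
  S     = filter (differ? u v) large
  open Route {t} {c} (capped c) c O E

  small-unique : Unique small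
  small-unique = Unique.map⁺ (inject≤-injective _ _ _ _) (Unique.allFin⁺ c)

  large-unique : Unique large
  large-unique = Unique.filter⁺ (λ i → c ≤? toℕ i) (Unique.allFin⁺ t)

  small-< : ∀ {i} → i ∈ small → toℕ i < c
  small-< i∈ with ∈-map⁻ _ i∈
  ... | j , _ , refl = subst (_< c) (sym (toℕ-inject≤ j _)) (toℕ<n j)

  small⁺ : ∀ i → toℕ i < c → i ∈ small
  small⁺ i i<c = subst (_∈ small)
    (toℕ-injective (trans (toℕ-inject≤ _ (<⇒≤ c<t)) (toℕ-fromℕ< i<c)))
    (∈-map⁺ _ (∈-allFin (fromℕ< i<c)))

  large-≤ : ∀ {i} → i ∈ large → c ≤ toℕ i
  large-≤ = proj₂ ∘ ∈-filter⁻ (λ i → c ≤? toℕ i) {xs = allFin t}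

  large-col : ∀ {i} → i ∈ large → capped c i ≡ c
  large-col = m≥n⇒m⊓n≡n ∘ large-≤

  split : small ↭ O ++ E
  split = filter-↭ (differ? u v) small

  len : length (O ++ E) ≡ c
  len = trans (sym (↭-length split)) (trans (length-map _ (allFin c)) (length-tabulate _))

  -- On `small` the capped colour is `toℕ`, which is injective with values below `c`.
  uniq : Unique (c ∷ map (capped c) (O ++ E))
  uniq = Unique-resp-↭ (prep c (map⁺ (capped c) split))
    (subst (Unique ∘ (c ∷_)) (sym (map-cong-local (All.tabulate (m≤n⇒m⊓n≡m ∘ <⇒≤ ∘ small-<))))
      (All.map⁺ (All.tabulate (≢-sym ∘ <⇒≢ ∘ small-<)) ∷ Unique.map⁺ toℕ-injective small-unique))

  OS-unique : Unique (O ++ S)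
  OS-unique = Unique.++⁺ (Unique.filter⁺ (differ? u v) small-unique) (Unique.filter⁺ (differ? u v) large-unique)
    λ (i∈O , i∈S) → <⇒≱ (small-< (proj₁ (∈-filter⁻ (differ? u v) i∈O))) (large-≤ (proj₁ (∈-filter⁻ (differ? u v) i∈S)))

  sound : ∀ i → i ∈ O ++ S → Vec.lookup u i ≢ Vec.lookup v i
  sound i i∈ with ∈-++⁻ O i∈
  ... | inj₁ i∈O = proj₂ (∈-filter⁻ (differ? u v) {xs = small} i∈O)
  ... | inj₂ i∈S = proj₂ (∈-filter⁻ (differ? u v) {xs = large} i∈S)

  complete : ∀ i → Vec.lookup u i ≢ Vec.lookup v i → i ∈ O ++ S
  complete i u≢v with c ≤? toℕ i
  ... | yes c≤i = ∈-++⁺ʳ O (∈-filter⁺ (differ? u v) (∈-filter⁺ (λ i → c ≤? toℕ i) (∈-allFin i) c≤i) u≢v)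
  ... | no  c≰i = ∈-++⁺ˡ (∈-filter⁺ (differ? u v) (small⁺ i (≰⇒> c≰i)) u≢v)

-- Flipping each differing direction once gives a path whose colours are all distinct, hence proper
-- for every distance.
injectiveColouring-connected : ∀ (col : Fin t → ℕ) → (∀ {i j} → col i ≡ col j → i ≡ j) →
  ∀ ℓ → DistanceProperConnected (Q t) (colouring col) ℓ
injectiveColouring-connected {t} col inj ℓ u v _ =
  connect col D (parity-differ u v D-unique (λ i → proj₂ ∘ ∈-filter⁻ (differ? u v) {xs = allFin t})
                   (λ i → ∈-filter⁺ (differ? u v) (∈-allFin i)))
    (Unique⇒NonReturning D-unique) (Unique⇒Spaced (Unique.map⁺ inj D-unique))
  where
  D : List (Fin t)
  D = filter (differ? u v) (allFin t)
  D-unique : Unique D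
  D-unique = Unique.filter⁺ (differ? u v) (Unique.allFin⁺ t)

-- Lower bound

module _ (c : EdgeColouring (Q t)) where
  open EdgeColouring c

  colour∈colours : ∀ {u v} (w : Walk (Q t) u v) (j : Fin (length (colours (Q t) c w))) →
    ∃[ x ] ∃[ y ] ∃[ e ] colour x y e ≡ lookup (colours (Q t) c w) j
  colour∈colours (e ◅ w) zero    = _ , _ , e , refl
  colour∈colours (e ◅ w) (suc j) = colour∈colours w j

  direction : ∀ {u v} (w : Walk (Q t) u v) → Fin (length (colours (Q t) c w)) → Fin t
  direction ((d , _) ◅ w) zero    = d
  direction (_       ◅ w) (suc j) = direction w j

  -- If the first edge leaves coordinate `i` alone, the difference persists to the rest of the walk.
  direction-surjective : ∀ {u v} (w : Walk (Q t) u v) i → Vec.lookup u i ≢ Vec.lookup v i →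
    ∃[ j ] direction w j ≡ i
  direction-surjective ε i u≢v = contradiction refl u≢v
  direction-surjective {u} (_◅_ {j = x} (d , _ , only) w) i u≢v
    with Vec.lookup u i Bool.≟ Vec.lookup x i
  ... | no  u≢x = zero , only u≢x
  ... | yes u≡x =
    let j , eq = direction-surjective w i (λ x≡v → u≢v (trans u≡x x≡v)) in suc j , eq

  antipodal-length : ∀ {u v} (w : Walk (Q t) u v) → (∀ i → Vec.lookup u i ≢ Vec.lookup v i) →
    t ≤ length (colours (Q t) c w)
  antipodal-length w u≢v = injective⇒≤ {f = λ i → proj₁ (direction-surjective w i (u≢v i))} λ {i} {j} eq →
    trans (sym (proj₂ (direction-surjective w i (u≢v i))))
      (trans (cong (direction w) eq) (proj₂ (direction-surjective w j (u≢v j))))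

  -- The bound `k ≤ t` provides `k` edges on an antipodal path, and `k ≤ suc ℓ` makes the colours of
  -- its first `k` edges distinct. It is applied with `k` equal to `t` and to `suc ℓ`.
  colours-lower-bound : ∀ {k m} → 1 ≤ t → k ≤ t → k ≤ suc ℓ →
    DistanceProperConnected (Q t) c ℓ → NumberOfColours (Q t) c m → k ≤ m
  colours-lower-bound {ℓ} {k} {m} 1≤t k≤t k≤1+ℓ conn (ks , len , _ , image) =
    subst (k ≤_) len (injective⇒≤ {f = f} f-injective)
    where
    zeros ones : Vec Bool t
    zeros = Vec.replicate t false
    ones  = Vec.replicate t true

    antipodal : ∀ i → Vec.lookup zeros i ≢ Vec.lookup ones i
    antipodal i eq with trans (sym (lookup-replicate i false)) (trans eq (lookup-replicate i true))
    ... | ()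

    path = conn zeros ones (λ eq → antipodal (fromℕ< 1≤t) (cong (λ x → Vec.lookup x (fromℕ< 1≤t)) eq))
    w    = proj₁ path
    cs   = colours (Q t) c w

    k≤len : k ≤ length cs
    k≤len = ≤-trans k≤t (antipodal-length w antipodal)

    pos : Fin k → Fin (length cs)
    pos i = inject≤ i k≤len

    mem : ∀ i → lookup cs (pos i) ∈ ks
    mem i = Equivalence.from (image _) (colour∈colours w (pos i))

    -- Sends an edge among the first `k` to the place of its colour in `ks`.
    f : Fin k → Fin (length ks)
    f i = Any.index (mem i)

    too-close : ∀ i j → i Fin.< j → lookup cs (pos i) ≢ lookup cs (pos j)
    -- The later position is at most ℓ, and strictly fewer edges than that lie in between.
    too-close i j i<j eq = <⇒≱ (<-≤-trans gap j≤ℓ) (proj₂ (proj₂ path) (pos i) (pos j) pi<pj eq)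
      where
      pi<pj : pos i Fin.< pos j
      pi<pj = subst₂ _<_ (sym (toℕ-inject≤ i _)) (sym (toℕ-inject≤ j _)) i<j
      gap : toℕ (pos j) ∸ suc (toℕ (pos i)) < toℕ (pos j)
      gap = ∸-monoʳ-< z<s pi<pj
      j≤ℓ : toℕ (pos j) ≤ ℓ
      j≤ℓ = subst (_≤ ℓ) (sym (toℕ-inject≤ j _)) (≤-pred (≤-trans (toℕ<n j) k≤1+ℓ))

    f-injective : ∀ {i j} → f i ≡ f j → i ≡ j
    f-injective {i} {j} eq with Fin.<-cmp i j | trans (lookup-index (mem i)) (trans (cong (lookup ks) eq) (sym (lookup-index (mem j))))
    ... | tri< i<j _ _ | same = contradiction same (too-close i j i<j)
    ... | tri≈ _ i≡j _ | _    = i≡j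
    ... | tri> _ _ j<i | same = contradiction (sym same) (too-close j i j<i)

-- The value in the two ranges of ℓ.

pc-large-distance : ∀ {t ℓ} → 1 ≤ t → t ≤ ℓ → IsPC₁ (Q t) ℓ t
pc-large-distance {t@(suc n)} {ℓ} 1≤t t≤ℓ =
  -- With `t = suc n` the largest direction is `n`, so capping at `n` merges no two directions.
  (cappedColouring n , injectiveColouring-connected (capped n) capped-injective ℓ , cappedColouring-number ≤-refl) ,
  λ c m → colours-lower-bound c 1≤t ≤-refl (m≤n⇒m≤1+n t≤ℓ)
  where
  capped≡toℕ : (i : Fin t) → capped n i ≡ toℕ i
  capped≡toℕ i = m≤n⇒m⊓n≡m (≤-pred (toℕ<n i))
  capped-injective : {i j : Fin t} → capped n i ≡ capped n j → i ≡ j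
  capped-injective {i} {j} eq = toℕ-injective (trans (sym (capped≡toℕ i)) (trans eq (capped≡toℕ j)))

pc-small-distance : ∀ {t ℓ} → ℓ < t → IsPC₁ (Q t) ℓ (suc ℓ)
pc-small-distance {ℓ = ℓ} ℓ<t =
  (cappedColouring ℓ , cappedColouring-connected ℓ<t , cappedColouring-number ℓ<t) ,
  λ c m → colours-lower-bound c (≤-trans (s≤s z≤n) ℓ<t) ℓ<t ≤-refl

theorem2p10 : ∀ (t ℓ : ℕ) → t ≥ 1 → ℓ ≥ 2 →
    (t ≡ 1 → IsPC₁ (Q t) ℓ 1)
    × (t ≡ 2 → IsPC₁ (Q t) ℓ 2)
    × (t ≥ 3 → ℓ ≥ t → IsPC₁ (Q t) ℓ t)
    × (t ≥ 3 → ℓ < t → IsPC₁ (Q t) ℓ (ℓ + 1))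
theorem2p10 t ℓ t≥1 ℓ≥2 =
  -- Since `ℓ ≥ 2`, the cases `t = 1` and `t = 2` fall into the range `t ≤ ℓ`.
  (λ { refl → pc-large-distance t≥1 (<⇒≤ ℓ≥2) }) ,
  (λ { refl → pc-large-distance t≥1 ℓ≥2 }) ,
  (λ _ → pc-large-distance t≥1) ,
  (λ _ ℓ<t → subst (IsPC₁ (Q t) ℓ) (+-comm 1 ℓ) (pc-small-distance ℓ<t))
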